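{- Let $G$ and $G+x$ be connected graphs, and let $ST(G)=(T,\mathcal F)$ be marked with respect to the set $N(x)$ of leaves. Suppose that $ST(G)$ contains one of the following: (case 1) a unique clique node $u$ the marker vertices of which are all perfect; or (case 2) a unique star node $u$ the marker vertices of which are all empty except its centre, which is perfect; or (case 3) a unique hybrid node $u$, which is prime. Then $ST(G+x)$ is obtained from $ST(G)$ by adding to the label of node $u$ a new marker vertex $q$ adjacent in $G(u)$ exactly to $P(u)$, and making a new leaf $x$ (attached to $u$) the opposite of $q$.
   Context: Graphs are finite, simple and undirected. $G+x$ is obtained from $G$ by adding a new vertex $x$ with neighbourhood $N(x)\subseteq V(G)$. For a vertex set $S$, $N(S)=(\bigcup_{y\in S}N(y))\setminus S$. Splits. A split of a connected graph is a bipartition $(A,B)$ of its vertex set with $|A|,|B|>1$ such that every vertex of $N(B)$ is adjacent to every vertex of $N(A)$. A star is a graph with at least three vertices having one vertex (its centre) adjacent to all others and no other edges. Cliques (complete graphs) and stars are degenerate; a graph with no split that is not degenerate is prime. Graph-labelled trees. A graph-labelled tree (GLT) $(T,\mathcal F)$ is a tree $T$ whose non-leaf vertices are called nodes (each of degree at least 3), where each node $u$ is labelled by a graph $G(u)\in\mathcal F$ together with a bijection $\rho_u$ from the tree-edges incident to $u$ to $V(u):=V(G(u))$. A node is called clique, star, prime, degenerate according to its label. Vertices of labels are marker vertices; edges of labels are label-edges. The extremities of a tree-edge $e$ are: at an end that is a node $u$, the marker vertex $\rho_u(e)$; at an end that is a leaf, the leaf itself. The two extremities of a tree-edge are opposite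 to each other. Two elements (leaves or marker vertices) are accessible from one another if there is a sequence of leaves and marker vertices joining them whose consecutive elements are either the two extremities of a tree-edge or the two vertices of a label-edge, with tree-edges and label-edges alternating. The accessibility graph of the GLT has the leaves of $T$ as vertices, distinct leaves being adjacent iff accessible from one another. Node-joins. For a tree-edge between nodes $u,u'$ with extremities $q\in V(u)$, $q'\in V(u')$, the node-join replaces $u,u'$ by one node labelled by the graph obtained from $G(u)$ and $G(u')$ by adding all edges between $N(q)$ and $N(q')$ and deleting $q,q'$. It is a clique-join if both labels are cliques, and a star-join if both are stars and exactly one of $q,q'$ is the centre of its star. A GLT is reduced if all its labels are prime or degenerate and no clique-join or star-join is possible. Every connected graph $G$ is the accessibility graph of a unique reduced GLT, the split-tree $ST(G)$. States. For a marker vertex $q\in V(u)$ corresponding to the tree-edge $e$, $L(q)$ is the set of leaves in the component of $T-e$ not containing $u$, and $A(q)$ is the set of leaves of $L(q)$ accessible from $q$. For a leaf $\ell$, $L(\ell)$ is the set of all other leaves and $A(\ell)=N_G(\ell)$. With respect to a set $S$ of leaves (here $S=N(x)$), a leaf or marker vertex $q$ is perfect if $S\cap L(q)=A(q)$, empty if $S\cap L(q)=\emptyset$, and mixed otherwise. $P(u)$ is the set of perfect marker vertices in $V(u)$. A node $u$ is hybrid if every $q\in V(u)$ is perfect or empty and the opposite of every $q\in V(u)$ is mixed. -}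

module Defs where

open import Data.Bool using (Bool; true; false; T)
open import Data.Fin using (Fin; zero; suc; _≟_)
open import Data.Fin.Subset using (Subset; _∈_; _∉_; ∣_∣; ∁)
open import Data.List using (List; _∷_; _∷ʳ_; length)
open import Data.List.Relation.Unary.Linked using (Linked)
open import Data.List.Relation.Unary.Unique.Propositional using (Unique)
open import Data.Nat using (ℕ; suc; _≤_; _<_)
open import Data.Product using (Σ; ∃; ∃!; ∃₂; _×_; _,_)
open import Data.Sum using (_⊎_; inj₁; inj₂)
open import Data.Vec using (lookup)
open import Function using (_⇔_)
open import Function.Definitions using (Bijective)
open import Level using (0ℓ)
open import Relation.Binary using (Rel; Symmetric; Irreflexive)
open import Relation.Binary.Construct.Closure.ReflexiveTransitive using (Star)
open import Relation.Binary.PropositionalEquality using (_≡_; _≢_; refl)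
open import Relation.Nullary using (Dec; yes; no; ¬_; contradiction)
open import Relation.Nullary.Decidable using (⌊_⌋; toWitness)
open import Relation.Unary using (Pred; Empty; _∩_; _≐_)

------------------------------------------------------------------------
-- Simple graphs; V is always one of the finite types Fin n and
-- Fin n ⊎ Fin k below.

record Graph (V : Set) : Set where
  field
    adj : V → V → Bool

  infix 4 _~_
  _~_ : Rel V 0ℓ
  a ~ b = T (adj a b)

  field
    ~-sym    : Symmetric _~_
    ~-irrefl : Irreflexive _≡_ _~_

-- G + x with N(x) = S: the new vertex is zero, the old vertices are the
-- successors.
addVertex : ∀ {n} → Graph (Fin n) → Subset n → Graph (Fin (suc n))
addVertex {n} G S = record
  { adj      = adj′
  ; ~-sym    = λ {a} {b} → adj′-sym a b
  ; ~-irrefl = λ { {a} refl → adj′-irrefl a }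
  }
  where
  open Graph G

  adj′ : Fin (suc n) → Fin (suc n) → Bool
  adj′ zero    zero    = false
  adj′ zero    (suc b) = lookup S b
  adj′ (suc a) zero    = lookup S a
  adj′ (suc a) (suc b) = adj a b

  adj′-sym : ∀ a b → T (adj′ a b) → T (adj′ b a)
  adj′-sym zero    (suc _) p = p
  adj′-sym (suc _) zero    p = p
  adj′-sym (suc _) (suc _) p = ~-sym p

  adj′-irrefl : ∀ a → ¬ T (adj′ a a)
  adj′-irrefl (suc _) p = ~-irrefl refl p

module _ {V : Set} (G : Graph V) where
  open Graph G

  Connected : Set
  Connected = ∀ a b → Star _~_ a b

  -- v ∷ vs lists the at least three distinct vertices of a cycle.
  Acyclic : Set
  Acyclic = ∀ (v : V) (vs : List V) → 2 ≤ length vs → Unique (v ∷ vs) →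
            ¬ Linked _~_ (v ∷ (vs ∷ʳ v))

  IsTree : Set
  IsTree = Connected × Acyclic

  -- Adjacency in the graph obtained by deleting the edge ab.
  DeleteEdge : V → V → Rel V 0ℓ
  DeleteEdge a b x y = x ~ y × ¬ (x ≡ a × y ≡ b ⊎ x ≡ b × y ≡ a)

module _ {m} (G : Graph (Fin m)) where
  open Graph G

  InNeighbourhood : Subset m → Fin m → Set
  InNeighbourhood S v = v ∉ S × ∃ λ y → y ∈ S × y ~ v

  -- The bipartition (A , ∁ A) is a split.
  IsSplit : Subset m → Set
  IsSplit A = 1 < ∣ A ∣ × 1 < ∣ ∁ A ∣ ×
    (∀ a b → InNeighbourhood (∁ A) a → InNeighbourhood A b → a ~ b)

  IsClique : Set
  IsClique = ∀ a b → a ≢ b → a ~ b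

  IsStarWithCentre : Fin m → Set
  IsStarWithCentre c = 3 ≤ m × (∀ v → v ≢ c → c ~ v) ×
                       (∀ a b → a ~ b → a ≡ c ⊎ b ≡ c)

  IsStar : Set
  IsStar = ∃ IsStarWithCentre

  IsDegenerate : Set
  IsDegenerate = IsClique ⊎ IsStar

  -- Splits are only defined for connected graphs, so a prime graph is
  -- connected.
  IsPrime : Set
  IsPrime = Connected G × (¬ ∃ IsSplit) × ¬ IsDegenerate

------------------------------------------------------------------------
-- Graph-labelled trees

pattern leaf ℓ     = inj₁ ℓ
pattern node u     = inj₂ u
pattern marker u q = inj₂ (u , q)

-- The data of a graph-labelled tree with leaf set Fin n; its axioms are
-- IsGLT below.
record RawGLT (n : ℕ) : Set where
  field
    #nodes : ℕ

  Node : Set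
  Node = Fin #nodes

  TreeVertex : Set
  TreeVertex = Fin n ⊎ Node

  field
    tree : Graph TreeVertex

  -- Tree-edges incident to a node u, each given by its other end.
  IncidentEdge : Node → Set
  IncidentEdge u = ∃ λ v → Graph._~_ tree (node u) v

  field
    size  : Node → ℕ
    label : (u : Node) → Graph (Fin (size u))
    ρ     : (u : Node) → IncidentEdge u → Fin (size u)

  open Graph tree public

  -- Leaves and marker vertices.
  Element : Set
  Element = Fin n ⊎ Σ Node (λ u → Fin (size u))

  extremity : ∀ {a b} → a ~ b → Element
  extremity {leaf ℓ} {b} _ = leaf ℓ
  extremity {node u} {b} e = marker u (ρ u (b , e))

  Opposite : Rel Element 0ℓ
  Opposite p q = ∃₂ λ a b → Σ (a ~ b) λ e →
    p ≡ extremity e × q ≡ extremity (~-sym e)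

  data LabelEdge : Rel Element 0ℓ where
    labelEdge : ∀ {u q q′} → Graph._~_ (label u) q q′ →
                LabelEdge (marker u q) (marker u q′)

  data Kind : Set where
    treeKind labelKind : Kind

  other : Kind → Kind
  other treeKind  = labelKind
  other labelKind = treeKind

  Step : Kind → Rel Element 0ℓ
  Step treeKind  = Opposite
  Step labelKind = LabelEdge

  -- Alternating sequences whose first step, if any, has the given kind.
  infixr 5 _∷_
  data Alternating : Kind → Rel Element 0ℓ where
    []  : ∀ {k p} → Alternating k p p
    _∷_ : ∀ {k p q r} → Step k p q → Alternating (other k) q r →
          Alternating k p r

  Accessible : Rel Element 0ℓ
  Accessible p q = ∃ λ k → Alternating k p q

  -- Adjacency in the accessibility graph.
  AccessibilityGraph : Rel (Fin n) 0ℓ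
  AccessibilityGraph ℓ ℓ′ = ℓ ≢ ℓ′ × Accessible (leaf ℓ) (leaf ℓ′)

  record IsGLT : Set where
    field
      isTree      : IsTree tree
      leaf-degree : ∀ ℓ → ∃! _≡_ (λ v → leaf ℓ ~ v)
      ρ-bijective : ∀ u → Bijective _≡_ _≡_ (ρ u)
      -- By ρ-bijective, size u is the degree of u.
      node-degree : ∀ u → 3 ≤ size u

  CliqueJoinPossible : Set
  CliqueJoinPossible = ∃₂ λ u u′ → ∃₂ λ q q′ →
    Opposite (marker u q) (marker u′ q′) ×
    IsClique (label u) × IsClique (label u′)

  StarJoinPossible : Set
  StarJoinPossible = ∃₂ λ u u′ → ∃₂ λ q q′ →
    Opposite (marker u q) (marker u′ q′) ×
    IsStar (label u) × IsStar (label u′) ×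
    ( (IsStarWithCentre (label u) q × ¬ IsStarWithCentre (label u′) q′)
    ⊎ (¬ IsStarWithCentre (label u) q × IsStarWithCentre (label u′) q′))

  IsReduced : Set
  IsReduced = (∀ u → IsPrime (label u) ⊎ IsDegenerate (label u)) ×
              ¬ CliqueJoinPossible × ¬ StarJoinPossible

-- Leaves are the vertices of G themselves, so this is the property that
-- characterises ST(G) (up to renaming nodes and marker vertices).
record _IsSplitTreeOf_ {n} (𝒯 : RawGLT n) (G : Graph (Fin n)) : Set where
  open RawGLT 𝒯 using (IsGLT; IsReduced; AccessibilityGraph)
  field
    isGLT         : IsGLT
    isReduced     : IsReduced
    accessibility : ∀ a b → Graph._~_ G a b ⇔ AccessibilityGraph a b

------------------------------------------------------------------------
-- States with respect to a set S of leaves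

module States {n} (𝒯 : RawGLT n) (S : Subset n) where
  open RawGLT 𝒯

  -- For a marker vertex of u, with tree-edge e = uv, the component of
  -- tree − e not containing u is the component of v.
  L : Element → Pred (Fin n) 0ℓ
  L (leaf ℓ)     ℓ′ = ℓ′ ≢ ℓ
  L (marker u q) ℓ′ = ∃ λ v → Σ (node u ~ v) λ e → ρ u (v , e) ≡ q ×
                      Star (DeleteEdge tree (node u) v) v (leaf ℓ′)

  -- For a leaf, A is the neighbourhood in the graph whose split-tree 𝒯 is,
  -- that is, in the accessibility graph of 𝒯.
  A : Element → Pred (Fin n) 0ℓ
  A (leaf ℓ)     = AccessibilityGraph ℓ
  A (marker u q) = L (marker u q) ∩ λ ℓ′ → Accessible (marker u q) (leaf ℓ′)

  IsPerfect : Element → Set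
  IsPerfect q = (_∈ S) ∩ L q ≐ A q

  IsEmpty : Element → Set
  IsEmpty q = Empty ((_∈ S) ∩ L q)

  IsMixed : Element → Set
  IsMixed q = ¬ IsPerfect q × ¬ IsEmpty q

  IsHybrid : Node → Set
  IsHybrid u = ∀ q →
    (IsPerfect (marker u q) ⊎ IsEmpty (marker u q)) ×
    (∀ r → Opposite (marker u q) r → IsMixed r)

  IsPerfectClique : Node → Set
  IsPerfectClique u = IsClique (label u) × ∀ q → IsPerfect (marker u q)

  IsCentrePerfectStar : Node → Set
  IsCentrePerfectStar u = ∃ λ c → IsStarWithCentre (label u) c ×
    IsPerfect (marker u c) × (∀ q → q ≢ c → IsEmpty (marker u q))

  -- P = P(u)
  IsPerfectSet : (u : Node) → Subset (size u) → Set
  IsPerfectSet u P = ∀ q → q ∈ P ⇔ IsPerfect (marker u q)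

  IsUnique : (Node → Set) → Node → Set
  IsUnique C u = C u × (∀ w → C w → w ≡ u)

------------------------------------------------------------------------
-- Attaching the new leaf zero to the node u, opposite to a new marker
-- vertex zero of u whose neighbourhood in the label is P; old leaves, and
-- old marker vertices of u, become successors.

module _ {n} (𝒯 : RawGLT n) (u : RawGLT.Node 𝒯) (P : Subset (RawGLT.size 𝒯 u)) where
  open RawGLT 𝒯

  private
    TreeVertex′ : Set
    TreeVertex′ = Fin (suc n) ⊎ Node

    adj′ : TreeVertex′ → TreeVertex′ → Bool
    adj′ (leaf zero)    (leaf _)       = false
    adj′ (leaf zero)    (node w)       = ⌊ w ≟ u ⌋
    adj′ (leaf (suc _)) (leaf zero)    = false
    adj′ (leaf (suc a)) (leaf (suc b)) = adj (leaf a) (leaf b)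
    adj′ (leaf (suc a)) (node w)       = adj (leaf a) (node w)
    adj′ (node w)       (leaf zero)    = ⌊ w ≟ u ⌋
    adj′ (node w)       (leaf (suc b)) = adj (node w) (leaf b)
    adj′ (node w)       (node w′)      = adj (node w) (node w′)

    adj′-sym : ∀ a b → T (adj′ a b) → T (adj′ b a)
    adj′-sym (leaf zero)    (node _)       e = e
    adj′-sym (leaf (suc _)) (leaf (suc _)) e = ~-sym e
    adj′-sym (leaf (suc _)) (node _)       e = ~-sym e
    adj′-sym (node _)       (leaf zero)    e = e
    adj′-sym (node _)       (leaf (suc _)) e = ~-sym e
    adj′-sym (node _)       (node _)       e = ~-sym e

    adj′-irrefl : ∀ a → ¬ T (adj′ a a)
    adj′-irrefl (leaf (suc _)) e = ~-irrefl refl e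
    adj′-irrefl (node _)       e = ~-irrefl refl e

  attachedTree : Graph TreeVertex′
  attachedTree = record
    { adj      = adj′
    ; ~-sym    = λ {a} {b} → adj′-sym a b
    ; ~-irrefl = λ { {a} refl → adj′-irrefl a }
    }

  attachedSize : ∀ w → Dec (w ≡ u) → ℕ
  attachedSize w (yes _) = suc (size w)
  attachedSize w (no  _) = size w

  attachedLabel : ∀ w (d : Dec (w ≡ u)) → Graph (Fin (attachedSize w d))
  attachedLabel w (yes refl) = addVertex (label u) P
  attachedLabel w (no _)     = label w

  attachedρ : ∀ w (d : Dec (w ≡ u)) →
              (∃ λ v → Graph._~_ attachedTree (node w) v) →
              Fin (attachedSize w d)
  attachedρ w (yes _)  (leaf zero    , _) = zero
  attachedρ w (yes _)  (leaf (suc ℓ) , e) = suc (ρ w (leaf ℓ , e))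
  attachedρ w (yes _)  (node v       , e) = suc (ρ w (node v , e))
  attachedρ w (no w≢u) (leaf zero    , e) = contradiction (toWitness e) w≢u
  attachedρ w (no _)   (leaf (suc ℓ) , e) = ρ w (leaf ℓ , e)
  attachedρ w (no _)   (node v       , e) = ρ w (node v , e)

  attachLeaf : RawGLT (suc n)
  attachLeaf = record
    { #nodes = #nodes
    ; tree   = attachedTree
    ; size   = λ w → attachedSize w (w ≟ u)
    ; label  = λ w → attachedLabel w (w ≟ u)
    ; ρ      = λ w → attachedρ w (w ≟ u)
    }

{-# OPTIONS --safe #-}
module Submission where

open import Defs
open import Data.Bool using (T)
open import Data.Bool.Properties using (T-irrelevant; T-≡; not-involutive)
open import Data.Fin using (Fin; zero; suc; fromℕ<; join; splitAt; _≟_)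
open import Data.Fin.Properties using (splitAt-join; injective⇒≤; suc-injective)
open import Data.Fin.Subset using (Subset; _∈_; ∣_∣; ∁; Nonempty; inside; outside)
open import Data.Fin.Subset.Properties using (x∈p∧x≢y⇒x∈p-y; x∈p⇒∣p-x∣<∣p∣; x∈p⇒x∉∁p; x∉p⇒x∈∁p)
open import Data.List as List using (List; []; _∷_; _∷ʳ_; length)
import Data.List.Membership.Propositional as Membership
open import Data.List.Membership.Propositional.Properties using (∈-lookup)
open import Data.List.Relation.Unary.All as All using (All; []; _∷_)
open import Data.List.Relation.Unary.All.Properties using (¬Any⇒All¬)
open import Data.List.Relation.Unary.Any as Any using (here; there)
open import Data.List.Relation.Unary.AllPairs using ([]; _∷_)
open import Data.List.Relation.Unary.Linked using (Linked; [-]; _∷_)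
open import Data.List.Relation.Unary.Unique.Propositional using (Unique)
open import Data.Nat using (ℕ; zero; suc; _+_; _≤_; _<_; z≤n; s≤s; _<?_)
open import Data.Nat.Properties using (≤-refl; ≤-trans; ≤-<-trans; <⇒≱; m≤n⇒m≤1+n; +-identityʳ; +-suc)
open import Data.Product using (∃; ∃₂; ∃!; _×_; _,_; proj₁; proj₂)
open import Data.Sum as Sum using (_⊎_; inj₁; inj₂; [_,_]′)
open import Data.Sum.Properties using (≡-dec)
open import Data.Vec using ([]; _∷_; lookup; tabulate; here; there)
open import Data.Vec.Properties using ([]=⇒lookup; lookup⇒[]=; lookup∘tabulate)
open import Function using (_∘_; case_of_; _⇔_; mk⇔; Equivalence)
open import Function.Definitions using (Injective; Bijective)
open import Level using (0ℓ)
open import Relation.Binary using (Rel; DecidableEquality)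
open import Relation.Binary.Construct.Closure.ReflexiveTransitive as Star using (Star; ε; _◅_; _◅◅_)
open import Relation.Binary.PropositionalEquality using (_≡_; _≢_; refl; sym; trans; cong; cong₂; subst; subst₂)
open import Relation.Nullary using (Dec; yes; no; ¬_; contradiction)
open import Relation.Nullary.Decidable using (toWitness; fromWitness)

-- Every path from the new leaf x enters u at q and leaves it through a marker
-- vertex of P(u), so the leaves accessible from x are the union of the A(r) with
-- r ∈ P(u); as each marker vertex of u is perfect or empty, this union is N(x).
-- Only the label of u changes. An all-perfect clique remains a clique, and in
-- case 2 a star keeps its centre. In case 3, a split of the new label makes q a
-- twin of, or pendant to, some marker vertex r, and then the opposite of r would
-- be perfect or empty instead of mixed. As no label changes its type, no join
-- becomes possible.

-- Walks and cycles

-- `Accessible` admits sequences that revisit elements, so the tree structure has to be recovered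
-- from alternation. Every element is the extremity of exactly one directed tree-edge, which
-- determines each tree step; a label-edge joins two distinct marker vertices, which prevents
-- turning back at a node. A sequence that enters a branch therefore descends through nested
-- branches. Perfect and empty would coincide for a marker vertex without accessible leaves and
-- without leaves of `S` behind it. In a reduced tree this cannot happen: no label has an isolated
-- vertex, so a descent can be continued until it reaches a leaf. Hence the alternative "perfect or
-- empty" that each case provides determines P(u). Connectedness of G+x gives x a neighbour, hence
-- P(u) an element; this keeps a prime label connected when q is added.

module _ {V : Set} (R : Rel V 0ℓ) where

  -- The list holds every vertex after the start, so a walk is simple when `Unique (x ∷ xs)` holds,
  -- and an edge back to the start turns it into the list form of a cycle.
  data Walk : V → V → List V → Set where
    []  : ∀ {x} → Walk x x []
    _∷_ : ∀ {x y z ys} → R x y → Walk y z ys → Walk x z (y ∷ ys)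

  private
    dropTo : ∀ {x y z ys} → Walk y z ys → Unique (y ∷ ys) → x Membership.∈ y ∷ ys →
             ∃ λ xs → Walk x z xs × Unique (x ∷ xs)
    dropTo w       uniq       (here refl) = _ , w , uniq
    dropTo (_ ∷ w) (_ ∷ uniq) (there x∈)  = dropTo w uniq x∈

  simpleWalk : DecidableEquality V → ∀ {x z} → Star R x z →
               ∃ λ xs → Walk x z xs × Unique (x ∷ xs)
  simpleWalk _≟ⱽ_ ε = [] , [] , [] ∷ []
  simpleWalk _≟ⱽ_ {x} (_◅_ {j = y} r rs) with simpleWalk _≟ⱽ_ rs
  ... | ys , w , uniq with Any.any? (x ≟ⱽ_) (y ∷ ys)
  ...   | yes x∈ = dropTo w uniq x∈
  ...   | no  x∉ = y ∷ ys , r ∷ w , ¬Any⇒All¬ _ x∉ ∷ uniq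

unique-length : ∀ {V : Set} {N} {f : V → Fin N} → Injective _≡_ _≡_ f →
                ∀ {xs} → Unique xs → length xs ≤ N
unique-length {f = f} f-injective {xs} uniq =
  injective⇒≤ (lookup-injective uniq _ _ ∘ f-injective)
  where
  lookup-injective : ∀ {xs} → Unique xs → ∀ i j →
                     List.lookup xs i ≡ List.lookup xs j → i ≡ j
  lookup-injective (_ ∷ _)    zero    zero    _  = refl
  lookup-injective (x∉ ∷ _)   zero    (suc j) eq = contradiction eq (All.lookup x∉ (∈-lookup j))
  lookup-injective (x∉ ∷ _)   (suc i) zero    eq = contradiction (sym eq) (All.lookup x∉ (∈-lookup i))
  lookup-injective (_ ∷ uniq) (suc i) (suc j) eq = cong suc (lookup-injective uniq i j eq)

module _ {V : Set} (G : Graph V) where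
  open Graph G

  delete-sym : ∀ {a b x y} → DeleteEdge G a b x y → DeleteEdge G a b y x
  delete-sym (e , ≢ab) = ~-sym e , λ
    { (inj₁ (refl , refl)) → ≢ab (inj₂ (refl , refl))
    ; (inj₂ (refl , refl)) → ≢ab (inj₁ (refl , refl)) }

  delete-flip : ∀ {a b x y} → DeleteEdge G a b x y → DeleteEdge G b a x y
  delete-flip (e , ≢ab) = e , λ
    { (inj₁ (refl , refl)) → ≢ab (inj₂ (refl , refl))
    ; (inj₂ (refl , refl)) → ≢ab (inj₁ (refl , refl)) }

  -- Acyclicity without lists of vertices: branches are handled in this form, and it passes to the
  -- attached tree by contracting the new edge.
  BridgesOnly : Set
  BridgesOnly = ∀ {a b} → a ~ b → ¬ Star (DeleteEdge G a b) b a

  -- A walk that bypasses `ab` can be made simple, and `ab` then closes it to a cycle.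
  acyclic⇒bridgesOnly : DecidableEquality V → Acyclic G → BridgesOnly
  acyclic⇒bridgesOnly _≟ⱽ_ acyclic {a} {b} e walk with simpleWalk _ _≟ⱽ_ walk
  ... | []         , []               , _    = ~-irrefl refl e
  -- A single step from `b` to `a` would be the deleted edge itself.
  ... | _ ∷ []     , ((_ , ≢ab) ∷ []) , _    = ≢ab (inj₂ (refl , refl))
  ... | x ∷ y ∷ xs , w                , uniq =
    acyclic b (x ∷ y ∷ xs) (s≤s (s≤s z≤n)) uniq (close w)
    where
    close : ∀ {z zs} → Walk (DeleteEdge G a b) z a zs → Linked _~_ (z ∷ (zs ∷ʳ b))
    close []              = e ∷ [-]
    close ((e′ , _) ∷ w′) = e′ ∷ close w′

  -- The rest of a cycle bypasses its first edge.
  bridgesOnly⇒acyclic : BridgesOnly → Acyclic G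
  bridgesOnly⇒acyclic bridge v (w ∷ w′ ∷ ws) _
    ((v≢w ∷ v≢w′ ∷ v≢ws) ∷ (w≢w′ ∷ w≢ws) ∷ _) (e ∷ e′ ∷ l) =
    bridge e ((e′ , ≢vw) ◅ walk (v≢w′ ∷ v≢ws) (w≢w′ ∷ w≢ws) l)
    where
    ≢vw : ¬ (w ≡ v × w′ ≡ w ⊎ w ≡ w × w′ ≡ v)
    ≢vw (inj₁ (w≡v , _))  = v≢w (sym w≡v)
    ≢vw (inj₂ (_ , w′≡v)) = v≢w′ (sym w′≡v)

    walk : ∀ {x xs} → All (v ≢_) (x ∷ xs) → All (w ≢_) (x ∷ xs) →
           Linked _~_ (x ∷ (xs ∷ʳ v)) → Star (DeleteEdge G v w) x v
    walk {xs = []} (v≢x ∷ _) (w≢x ∷ _) (d ∷ _) =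
      (d , λ { (inj₁ (x≡v , _)) → v≢x (sym x≡v) ; (inj₂ (x≡w , _)) → w≢x (sym x≡w) }) ◅ ε
    walk {xs = _ ∷ _} (v≢x ∷ v≢xs) (w≢x ∷ w≢xs) (d ∷ l) =
      (d , λ { (inj₁ (x≡v , _)) → v≢x (sym x≡v) ; (inj₂ (x≡w , _)) → w≢x (sym x≡w) })
      ◅ walk v≢xs w≢xs l
  bridgesOnly⇒acyclic bridge v (_ ∷ []) (s≤s ()) _ _

-- Branches of a tree

module Branches {V : Set} (G : Graph V) (_≟ⱽ_ : DecidableEquality V)
                (connected : Connected G) (bridge : BridgesOnly G) where
  open Graph G

  -- For an edge ab, the vertices of the component of b in G − ab.
  Branch : V → V → V → Set
  Branch a b = Star (DeleteEdge G a b) b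

  private
    Avoiding : V → Rel V 0ℓ
    Avoiding a x y = x ~ y × x ≢ a × y ≢ a

    avoiding-sym : ∀ {a x y} → Avoiding a x y → Avoiding a y x
    avoiding-sym (e , x≢a , y≢a) = ~-sym e , y≢a , x≢a

    avoiding⇒delete : ∀ {a b x y} → Avoiding a x y → DeleteEdge G a b x y
    avoiding⇒delete (e , x≢a , y≢a) = e , λ
      { (inj₁ (x≡a , _)) → x≢a x≡a ; (inj₂ (_ , y≡a)) → y≢a y≡a }

    -- The prefix walked so far is carried along in `go`: if it ever reached `a`, it would bypass
    -- the bridge `ab`.
    branch-avoids : ∀ {a b c} → a ~ b → Branch a b c → Star (Avoiding a) b c
    branch-avoids {a} {b} e = go ε
      where
      go : ∀ {x c} → Branch a b x → Star (DeleteEdge G a b) x c → Star (Avoiding a) x c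
      go _ ε        = ε
      go p (d ◅ ds) =
        (proj₁ d , (λ { refl → bridge e p }) , λ { refl → bridge e p′ }) ◅ go p′ ds
        where p′ = p ◅◅ (d ◅ ε)

  -- Otherwise a walk from `b` through `c` to `b′` avoids `a` on its second half, and the edge from
  -- `b′` to `a` completes a bypass of `ab`.
  branch-disjoint : ∀ {a b b′ c} → a ~ b → a ~ b′ →
                    Branch a b c → Branch a b′ c → b ≡ b′
  branch-disjoint {a} {b} {b′} e e′ p p′ with b ≟ⱽ b′
  ... | yes b≡b′ = b≡b′
  ... | no  b≢b′ = contradiction
    (p ◅◅ Star.map avoiding⇒delete (Star.reverse avoiding-sym (branch-avoids e′ p′))
       ◅◅ ((~-sym e′ , λ { (inj₁ (refl , _)) → ~-irrefl refl e′
                         ; (inj₂ (b′≡b , _)) → b≢b′ (sym b′≡b) }) ◅ ε))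
    (bridge e)

  branch-opposite : ∀ {a b c} → a ~ b → Branch a b c → ¬ Branch b a c
  branch-opposite e p p′ =
    bridge e (p ◅◅ Star.map (delete-flip G) (Star.reverse (delete-sym G) p′))

  -- Beyond `c` the walk never returns to `b`, so it cannot use the edge `ab`.
  branch-enter : ∀ {a b c d} → b ~ c → c ≢ a → Branch b c d → a ~ b → Branch a b d
  branch-enter e c≢a p e′ =
    (e , λ { (inj₁ (refl , _)) → ~-irrefl refl e′
           ; (inj₂ (_ , c≡a)) → c≢a c≡a })
    ◅ Star.map (delete-flip G ∘ avoiding⇒delete) (branch-avoids e p)

  -- The branch is the one entered after the last visit to `a` on a walk to `d`. `go` works
  -- backwards from `d`; `inj₁` means that `a` has not been met as the start of a step.
  branch-cover : ∀ {a d} → d ≢ a → ∃ λ b → a ~ b × Branch a b d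
  branch-cover {a} {d} d≢a = case go (connected a d) of λ where
      (inj₁ ε)                   → contradiction refl d≢a
      (inj₁ ((_ , a≢a , _) ◅ _)) → contradiction refl a≢a
      (inj₂ found)               → found
    where
    go : ∀ {x} → Star _~_ x d → Star (Avoiding a) x d ⊎ ∃ λ b → a ~ b × Branch a b d
    go ε = inj₁ ε
    go {x} (_◅_ {j = y} e es) with go es
    ... | inj₂ found = inj₂ found
    ... | inj₁ p with x ≟ⱽ a | y ≟ⱽ a
    ...   | yes refl | _        = inj₂ (y , e , Star.map avoiding⇒delete p)
    ...   | no  x≢a  | no  y≢a  = inj₁ ((e , x≢a , y≢a) ◅ p)
    ...   | no  _    | yes refl = case p of λ where
      ε                   → contradiction refl d≢a
      ((_ , a≢a , _) ◅ _) → contradiction refl a≢a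

-- Subsets and labels

module _ {n} {p : Subset n} {x : Fin n} where

  ∈⇒T : x ∈ p → T (lookup p x)
  ∈⇒T x∈p = subst T (sym ([]=⇒lookup x∈p)) _

  T⇒∈ : T (lookup p x) → x ∈ p
  T⇒∈ t = lookup⇒[]= x p (Equivalence.to T-≡ t)

two-elements : ∀ {n} {p : Subset n} {x y} → x ∈ p → y ∈ p → x ≢ y → 1 < ∣ p ∣
two-elements x∈p y∈p x≢y =
  ≤-<-trans (≤-<-trans z≤n (x∈p⇒∣p-x∣<∣p∣ (x∈p∧x≢y⇒x∈p-y x∈p x≢y))) (x∈p⇒∣p-x∣<∣p∣ y∈p)

0<∣p∣⇒nonempty : ∀ {n} (p : Subset n) → 0 < ∣ p ∣ → Nonempty p
0<∣p∣⇒nonempty (inside ∷ p)  _ = zero , here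
0<∣p∣⇒nonempty (outside ∷ p) h with 0<∣p∣⇒nonempty p h
... | x , x∈p = suc x , there x∈p

∁-involutive : ∀ {n} (p : Subset n) → ∁ (∁ p) ≡ p
∁-involutive []      = refl
∁-involutive (x ∷ p) = cong₂ _∷_ (not-involutive x) (∁-involutive p)

third : ∀ {m} → 3 ≤ m → (a b : Fin m) → ∃ λ t → t ≢ a × t ≢ b
third (s≤s (s≤s (s≤s _))) zero          zero          = suc zero , (λ ()) , λ ()
third (s≤s (s≤s (s≤s _))) zero          (suc zero)    = suc (suc zero) , (λ ()) , λ ()
third (s≤s (s≤s (s≤s _))) zero          (suc (suc _)) = suc zero , (λ ()) , λ ()
third (s≤s (s≤s (s≤s _))) (suc zero)    zero          = suc (suc zero) , (λ ()) , λ ()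
third (s≤s (s≤s (s≤s _))) (suc (suc _)) zero          = suc zero , (λ ()) , λ ()
third (s≤s (s≤s (s≤s _))) (suc _)       (suc _)       = zero , (λ ()) , λ ()

module _ {m} (G : Graph (Fin m)) where
  open Graph G

  -- This allows the side of a split that contains the new vertex to be called `A`.
  split-sym : ∀ {A} → IsSplit G A → IsSplit G (∁ A)
  split-sym {A} (1<∣A∣ , 1<∣∁A∣ , joined) =
    1<∣∁A∣ ,
    subst (λ B → 1 < ∣ B ∣) (sym (∁-involutive A)) 1<∣A∣ ,
    λ a b a∈N b∈N → ~-sym (joined b a b∈N
      (subst (λ B → InNeighbourhood G B a) (∁-involutive A) a∈N))

  -- This is what lets a path that has entered a node leave it again.
  neighbour : 3 ≤ m → IsPrime G ⊎ IsDegenerate G → ∀ q → ∃ λ q′ → q ~ q′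
  neighbour 3≤m (inj₁ (connected , _)) q with third 3≤m q q
  ... | t , t≢q , _ with connected q t
  ...   | ε     = contradiction refl t≢q
  ...   | e ◅ _ = _ , e
  neighbour 3≤m (inj₂ (inj₁ clique)) q with third 3≤m q q
  ... | t , t≢q , _ = t , clique q t (t≢q ∘ sym)
  neighbour 3≤m (inj₂ (inj₂ (c , _ , centre , _))) q with q ≟ c
  ... | no  q≢c  = c , ~-sym (centre q q≢c)
  ... | yes refl with third 3≤m q q
  ...   | t , t≢q , _ = t , centre t t≢q

  clique⇒¬star : IsClique G → ¬ IsStar G
  clique⇒¬star clique (c , 3≤m , _ , only) with third 3≤m c c
  ... | s , s≢c , _ with third 3≤m c s
  ...   | t , t≢c , t≢s = [ s≢c , t≢c ]′ (only s t (clique s t (t≢s ∘ sym)))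

  centre-unique : ∀ {c d} → IsStarWithCentre G c → IsStarWithCentre G d → d ≡ c
  centre-unique {c} {d} (3≤m , _ , only) (_ , centre , _) with third 3≤m c d
  ... | t , t≢c , t≢d =
    [ (λ d≡c → d≡c) , (λ t≡c → contradiction t≡c t≢c) ]′ (only d t (centre t t≢d))

-- Adding a vertex to a label

module _ {m} (G : Graph (Fin m)) (P : Subset m) where
  open Graph G
  private
    module G′ = Graph (addVertex G P)

  addVertex-clique⇒clique : IsClique (addVertex G P) → IsClique G
  addVertex-clique⇒clique clique a b a≢b = clique (suc a) (suc b) (a≢b ∘ suc-injective)

  addVertex-star⇒star : 3 ≤ m → ∀ {c} → IsStarWithCentre (addVertex G P) (suc c) →
                        IsStarWithCentre G c
  addVertex-star⇒star 3≤m (_ , centre , only) =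
    3≤m ,
    (λ v v≢c → centre (suc v) (v≢c ∘ suc-injective)) ,
    λ a b e → Sum.map suc-injective suc-injective (only (suc a) (suc b) e)

  addVertex-clique : IsClique G → (∀ q → q ∈ P) → IsClique (addVertex G P)
  addVertex-clique clique all zero    zero    0≢0 = contradiction refl 0≢0
  addVertex-clique clique all zero    (suc b) _   = ∈⇒T (all b)
  addVertex-clique clique all (suc a) zero    _   = ∈⇒T (all a)
  addVertex-clique clique all (suc a) (suc b) a≢b = clique a b (a≢b ∘ cong suc)

  addVertex-star : ∀ {c} → IsStarWithCentre G c → (∀ q → q ∈ P ⇔ q ≡ c) →
                   IsStarWithCentre (addVertex G P) (suc c)
  addVertex-star {c} (3≤m , centre , only) P⇔ = m≤n⇒m≤1+n 3≤m , centre′ , only′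
    where
    centre′ : ∀ v → v ≢ suc c → suc c G′.~ v
    centre′ zero    _   = ∈⇒T (Equivalence.from (P⇔ c) refl)
    centre′ (suc v) v≢c = centre v (v≢c ∘ cong suc)

    only′ : ∀ a b → a G′.~ b → a ≡ suc c ⊎ b ≡ suc c
    only′ zero    (suc b) e = inj₂ (cong suc (Equivalence.to (P⇔ b) (T⇒∈ e)))
    only′ (suc a) zero    e = inj₁ (cong suc (Equivalence.to (P⇔ a) (T⇒∈ e)))
    only′ (suc a) (suc b) e = Sum.map (cong suc) (cong suc) (only a b e)

  -- A split of G + x has x on a side of size two, since otherwise it restricts
  -- to a split of G; then x and its companion r are twins, or one of them
  -- is pendant to the other.
  addVertex-prime : 3 ≤ m → IsPrime G → Nonempty P →
    (∀ r → ¬ (∀ y → y ∈ P → y ≡ r)) →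
    (∀ r → ¬ (∀ y → y ≢ r → y ∈ P ⇔ r ~ y)) →
    IsPrime (addVertex G P)
  addVertex-prime 3≤m prime@(connected , ¬split , ¬degenerate) (p , p∈P) ¬pendant ¬twin =
    connected′ , (λ (A , split) → noSplit A split) , ¬degenerate′
    where
    lift : ∀ {a b} → Star _~_ a b → Star G′._~_ (suc a) (suc b)
    lift = Star.gmap suc (λ e → e)

    connected′ : Connected (addVertex G P)
    connected′ zero    zero    = ε
    connected′ zero    (suc b) = ∈⇒T p∈P ◅ lift (connected p b)
    connected′ (suc a) zero    = lift (connected a p) ◅◅ (∈⇒T p∈P ◅ ε)
    connected′ (suc a) (suc b) = lift (connected a b)

    ¬degenerate′ : ¬ IsDegenerate (addVertex G P)
    ¬degenerate′ (inj₁ clique) = ¬degenerate (inj₁ (addVertex-clique⇒clique clique))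
    ¬degenerate′ (inj₂ (suc c , star)) = ¬degenerate (inj₂ (c , addVertex-star⇒star 3≤m star))
    -- With the new vertex as centre, no two old vertices would be adjacent, but `p` has an old
    -- neighbour.
    ¬degenerate′ (inj₂ (zero , _ , _ , only)) with neighbour G 3≤m (inj₁ prime) p
    ... | y , p~y = case only (suc p) (suc y) p~y of λ { (inj₁ ()) ; (inj₂ ()) }

    noSplit-inside : ∀ A → ¬ IsSplit (addVertex G P) (inside ∷ A)
    noSplit-inside A (s≤s 0<∣A∣ , 1<∣∁A∣ , joined) with 1 <? ∣ A ∣
    ... | yes 1<∣A∣ = ¬split (A , 1<∣A∣ , 1<∣∁A∣ , λ a b a∈N b∈N →
      joined (suc a) (suc b) (raise a∈N) (raise b∈N))
      where
      raise : ∀ {s B v} → InNeighbourhood G B v → InNeighbourhood (addVertex G P) (s ∷ B) (suc v)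
      raise (v∉B , y , y∈B , y~v) = (λ { (there v∈B) → v∉B v∈B }) , suc y , there y∈B , y~v
    ... | no 1≮∣A∣ with 0<∣p∣⇒nonempty A 0<∣A∣
    -- The companion `r` is on the border of `A`, since it has an old neighbour. A vertex `y ≢ r` of
    -- `P` would put the new vertex on that border as well, and the split would then give both the
    -- same neighbours outside `A`. This excludes such a `y`, which leaves `r` alone in `P`.
    ...   | r , r∈A = ¬pendant r λ y y∈P → case y ≟ r of λ where
          (yes y≡r) → y≡r
          (no  y≢r) → contradiction (twin y y≢r y∈P) (¬twin r)
      where
      A⇒≡r : ∀ {y} → y ∈ A → y ≡ r
      A⇒≡r {y} y∈A with y ≟ r
      ... | yes y≡r = y≡r
      ... | no  y≢r = contradiction (two-elements y∈A r∈A y≢r) 1≮∣A∣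

      ≢r⇒∁A : ∀ {y} → y ≢ r → y ∈ ∁ A
      ≢r⇒∁A y≢r = x∉p⇒x∈∁p (y≢r ∘ A⇒≡r)

      A-border : ∀ {v y} → v ∈ inside ∷ A → y ≢ r → suc y G′.~ v →
                 InNeighbourhood (addVertex G P) (outside ∷ ∁ A) v
      A-border v∈A y≢r y~v = x∈p⇒x∉∁p v∈A , _ , there (≢r⇒∁A y≢r) , y~v

      ∁A-border : ∀ {v y} → v ≢ r → y ∈ inside ∷ A → y G′.~ suc v →
                  InNeighbourhood (addVertex G P) (inside ∷ A) (suc v)
      ∁A-border v≢r y∈A y~v = (λ { (there v∈A) → v≢r (A⇒≡r v∈A) }) , _ , y∈A , y~v

      r-border : InNeighbourhood (addVertex G P) (outside ∷ ∁ A) (suc r)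
      r-border with neighbour G 3≤m (inj₁ prime) r
      ... | y , r~y = A-border {y = y} (there r∈A) (λ { refl → ~-irrefl refl r~y }) (~-sym r~y)

      twin : ∀ y → y ≢ r → y ∈ P → ∀ z → z ≢ r → z ∈ P ⇔ r ~ z
      twin y y≢r y∈P z z≢r = mk⇔
        (λ z∈P → joined (suc r) (suc z) r-border (∁A-border z≢r here (∈⇒T z∈P)))
        (λ r~z → T⇒∈ (joined zero (suc z) (A-border {y = y} here y≢r (∈⇒T y∈P))
                       (∁A-border z≢r (there r∈A) r~z)))

    noSplit : ∀ A → ¬ IsSplit (addVertex G P) A
    noSplit (inside ∷ A)  split = noSplit-inside A split
    noSplit (outside ∷ A) split = noSplit-inside (∁ A) (split-sym (addVertex G P) split)

-- Graph-labelled trees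

module GLT {n} (𝒯 : RawGLT n) (isGLT : RawGLT.IsGLT 𝒯) where
  open RawGLT 𝒯 public
  open IsGLT isGLT public

  _≟ⱽ_ : DecidableEquality TreeVertex
  _≟ⱽ_ = ≡-dec _≟_ _≟_

  bridge : BridgesOnly tree
  bridge = acyclic⇒bridgesOnly tree _≟ⱽ_ (proj₂ isTree)

  open Branches tree _≟ⱽ_ (proj₁ isTree) bridge public

  leaf-edge-unique : ∀ {ℓ v v′} → leaf ℓ ~ v → leaf ℓ ~ v′ → v ≡ v′
  leaf-edge-unique {ℓ} e e′ with leaf-degree ℓ
  ... | _ , _ , unique = trans (sym (unique e)) (unique e′)

  ρ-injective : ∀ {u v v′} {e : node u ~ v} {e′ : node u ~ v′} →
                ρ u (v , e) ≡ ρ u (v′ , e′) → v ≡ v′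
  ρ-injective {u} eq = cong proj₁ (proj₁ (ρ-bijective u) eq)

  ρ-surjective : ∀ u q → ∃₂ λ v (e : node u ~ v) → ρ u (v , e) ≡ q
  ρ-surjective u q with proj₂ (ρ-bijective u) q
  ... | (v , e) , eq = v , e , eq refl

  element-node : ∀ {u u′ q q′} → _≡_ {A = Element} (marker u q) (marker u′ q′) → u ≡ u′
  element-node refl = refl

  element-marker : ∀ {u q q′} → _≡_ {A = Element} (marker u q) (marker u q′) → q ≡ q′
  element-marker refl = refl

  Arc : Set
  Arc = ∃₂ λ a b → a ~ b

  arc-≡ : ∀ {a b b′} {e : a ~ b} {e′ : a ~ b′} → b ≡ b′ → _≡_ {A = Arc} (a , b , e) (a , b′ , e′)
  arc-≡ refl = cong (λ e → _ , _ , e) (T-irrelevant _ _)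

  -- A leaf has only one edge, and `ρ` is injective at a node. This makes `Opposite` a function, so
  -- that the tree steps of a path are forced.
  extremity-injective : ∀ {a b a′ b′} (e : a ~ b) (e′ : a′ ~ b′) →
                        extremity e ≡ extremity e′ → _≡_ {A = Arc} (a , b , e) (a′ , b′ , e′)
  extremity-injective {leaf _} {a′ = leaf _} e e′ refl = arc-≡ (leaf-edge-unique e e′)
  extremity-injective {node _} {a′ = node _} e e′ eq with element-node eq
  ... | refl = arc-≡ (ρ-injective (element-marker eq))

  data IsExtremity : Element → Set where
    isExtremity : ∀ {a b} (e : a ~ b) → IsExtremity (extremity e)

  everyExtremity : ∀ p → IsExtremity p
  everyExtremity (leaf ℓ) = isExtremity (proj₁ (proj₂ (leaf-degree ℓ)))
  everyExtremity (marker u q) with ρ-surjective u q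
  ... | _ , e , refl = isExtremity e

  opposite : ∀ {a b} (e : a ~ b) → Opposite (extremity e) (extremity (~-sym e))
  opposite e = _ , _ , e , refl , refl

  opposite-unique : ∀ {p x y} → Opposite p x → Opposite p y → x ≡ y
  opposite-unique (_ , _ , e , p≡ , refl) (_ , _ , e′ , p≡′ , refl) =
    cong (λ (_ , _ , e) → extremity (~-sym e)) (extremity-injective e e′ (trans (sym p≡) p≡′))

  opposite-sym : ∀ {p q} → Opposite p q → Opposite q p
  opposite-sym (a , b , e , p≡ , q≡) =
    b , a , ~-sym e , q≡ , trans p≡ (cong extremity (T-irrelevant e (~-sym (~-sym e))))

  step-sym : ∀ k {p q} → Step k p q → Step k q p
  step-sym treeKind  opp           = opposite-sym opp
  step-sym labelKind (labelEdge e) = labelEdge (Graph.~-sym (label _) e)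

  accessible-sym : ∀ {p q} → Accessible p q → Accessible q p
  accessible-sym (_ , path) = go path []
    where
    -- The part already reversed begins with the other kind than the part still to come, so
    -- prepending a reversed step keeps the alternation.
    go : ∀ {k p q r} → Alternating k p q → Alternating (other k) p r → Accessible q r
    go {k}         []         acc = other k , acc
    go {treeKind}  (s ∷ path) acc = go path (step-sym treeKind s ∷ acc)
    go {labelKind} (s ∷ path) acc = go path (step-sym labelKind s ∷ acc)

  accessibility-sym : ∀ {a b} → AccessibilityGraph a b → AccessibilityGraph b a
  accessibility-sym (a≢b , acc) = a≢b ∘ sym , accessible-sym acc

  -- A label-edge has distinct ends, so a path leaves each node by another edge than the one it came
  -- by, and every tree step goes deeper into the branch.
  extremity-path : ∀ {a c b} (e : a ~ c) → Alternating labelKind (extremity (~-sym e)) (leaf b) →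
                   Branch a c (leaf b)
  extremity-path {c = leaf _} e [] = ε
  extremity-path {c = node w} e (labelEdge q~q′ ∷ (node _ , c , e′ , refl , refl) ∷ path) =
    branch-enter e′
      (λ { refl → Graph.~-irrefl (label w) (cong (λ e → ρ w (c , e)) (T-irrelevant _ _)) q~q′ })
      (extremity-path e′ path) e

  marker-path : ∀ {u v b} (e : node u ~ v) → Alternating treeKind (extremity e) (leaf b) →
                Alternating labelKind (extremity (~-sym e)) (leaf b)
  marker-path e (opp ∷ path) with opposite-unique opp (opposite e)
  ... | refl = path

  -- Descending to an accessible leaf

  module _ (reduced : IsReduced) where

    label-neighbour : ∀ {w} q → ∃ λ q′ → Graph._~_ (label w) q q′
    label-neighbour {w} = neighbour (label w) (node-degree w) (proj₁ reduced w)

    accessible-leaf : ∀ {u v} (e : node u ~ v) →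
                      ∃ λ b → Alternating treeKind (extremity e) (leaf b)
    -- There are `n + #nodes` tree vertices; with one more unit of fuel, it can run out only when
    -- `xs` has become too long to be free of repetitions.
    accessible-leaf e = descend (suc (n + #nodes)) e [] [] [] ≤-refl
      where
      encode-injective : Injective _≡_ _≡_ (join n #nodes)
      encode-injective {x} {y} eq =
        trans (sym (splitAt-join n _ x)) (trans (cong (splitAt n) eq) (splitAt-join n _ y))

      -- xs lists the vertices left behind on the way to v; having no repetitions,
      -- it cannot outgrow the tree.
      descend : ∀ fuel {u v} (e : node u ~ v) xs → Unique xs →
                All (λ x → ¬ Branch (node u) v x) xs → n + #nodes < length xs + fuel →
                ∃ λ b → Alternating treeKind (extremity e) (leaf b)
      descend _ {v = leaf b} e _ _ _ _ = b , opposite e ∷ []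
      descend zero {v = node w} e xs uniq _ long =
        contradiction (unique-length encode-injective uniq)
          (<⇒≱ (subst (n + #nodes <_) (+-identityʳ _) long))
      descend (suc fuel) {u} {node w} e xs uniq behind long
        with label-neighbour (ρ w (node u , ~-sym e))
      ... | q′ , q~q′ with ρ-surjective w q′
      ... | c , e′ , refl =
        let b , path = descend fuel e′ (node w ∷ xs)
              (¬Any⇒All¬ xs (λ w∈xs → All.lookup behind w∈xs ε) ∷ uniq)
              -- The branch beyond `c` lies in the branch beyond `w`, so it misses all earlier
              -- vertices; it misses `w` because the edge from `w` to `c` is a bridge.
              (bridge e′ ∷ All.map (λ ∉branch p → ∉branch (branch-enter e′ c≢u p e)) behind)
              (subst (n + #nodes <_) (+-suc _ fuel) long)
        in b , opposite e ∷ labelEdge q~q′ ∷ path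
        where
        c≢u : c ≢ node u
        c≢u refl = Graph.~-irrefl (label w) (cong (λ e → ρ w (c , e)) (T-irrelevant _ _)) q~q′

-- States

module StateProperties {n} (𝒯 : RawGLT n) (isGLT : RawGLT.IsGLT 𝒯) (S : Subset n) where
  open GLT 𝒯 isGLT
  open States 𝒯 S

  -- This unifies the two clauses of `L`: all other leaves lie beyond the only edge at a leaf.
  L⇔branch : ∀ {a c b} (e : a ~ c) → L (extremity e) b ⇔ Branch a c (leaf b)
  L⇔branch {leaf ℓ} {c} {b} e = mk⇔ to (λ { p refl → bridge e p })
    where
    to : b ≢ ℓ → Branch (leaf ℓ) c (leaf b)
    to b≢ℓ with branch-cover {leaf ℓ} {leaf b} (λ { refl → b≢ℓ refl })
    ... | c′ , e′ , p with leaf-edge-unique e e′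
    ... | refl = p
  L⇔branch {node u} {c} {b} e = mk⇔ to (λ p → c , e , refl , p)
    where
    to : L (extremity e) b → Branch (node u) c (leaf b)
    to (c′ , e′ , eq , p) with ρ-injective eq
    ... | refl = p

  L-cover : ∀ u b → ∃ λ q → L (marker u q) b
  L-cover u b with branch-cover {node u} {leaf b} (λ ())
  ... | v , e , p = ρ u (v , e) , v , e , refl , p

  L-disjoint : ∀ {u q q′ b} → L (marker u q) b → L (marker u q′) b → q ≡ q′
  L-disjoint {u} (_ , e , refl , p) (_ , e′ , refl , p′) with branch-disjoint e e′ p p′
  ... | refl = cong (λ e → ρ u (_ , e)) (T-irrelevant _ _)

  path⇒L : ∀ {u q b} → Alternating treeKind (marker u q) (leaf b) → L (marker u q) b
  path⇒L {u} {q} path with ρ-surjective u q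
  ... | v , e , refl = v , e , refl , extremity-path e (marker-path e path)

  -- `Accessible` leaves the kind of the first step open; for the leaves counted by `A` it is always
  -- the tree-edge of the element.
  A⇔path : ∀ {a c b} (e : a ~ c) →
           A (extremity e) b ⇔ Alternating labelKind (extremity (~-sym e)) (leaf b)
  A⇔path {leaf ℓ} {c} {b} e = mk⇔ to λ path →
    (λ { refl → bridge e (extremity-path e path) }) , treeKind , opposite e ∷ path
    where
    to : AccessibilityGraph ℓ b → Alternating labelKind (extremity (~-sym e)) (leaf b)
    to (ℓ≢b , _         , [])         = contradiction refl ℓ≢b
    to (_   , treeKind  , opp ∷ path) with opposite-unique opp (opposite e)
    ... | refl = path
  A⇔path {node u} {c} {b} e = mk⇔ to λ path →
    (c , e , refl , extremity-path e path) , treeKind , opposite e ∷ path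
    where
    to : A (extremity e) b → Alternating labelKind (extremity (~-sym e)) (leaf b)
    to (_ , treeKind , path) = marker-path e path
    -- After a label-edge to `q′` the path ends in `L` of `q′`, and a leaf lies in `L` of only one
    -- marker vertex of `u`.
    to (b∈L , labelKind , labelEdge q~q′ ∷ path) =
      contradiction q~q′ (Graph.~-irrefl (label u) (L-disjoint b∈L (path⇒L path)))

  A-marker⇔path : ∀ {u q b} → A (marker u q) b ⇔ Alternating treeKind (marker u q) (leaf b)
  A-marker⇔path {u} {q} = mk⇔ to λ path → path⇒L path , treeKind , path
    where
    to : ∀ {b} → A (marker u q) b → Alternating treeKind (marker u q) (leaf b)
    to b∈A with ρ-surjective u q
    ... | _ , e , refl = opposite e ∷ Equivalence.to (A⇔path e) b∈A

  -- A path entering `u` along `e` must continue by a label-edge. Together with `L-opposite⇔` this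
  -- expresses the state of the opposite through the marker vertices of `u`.
  A-opposite⇔ : ∀ {u v b} (e : node u ~ v) → A (extremity (~-sym e)) b ⇔
                (∃ λ q → Graph._~_ (label u) (ρ u (v , e)) q × A (marker u q) b)
  A-opposite⇔ {u} {v} {b} e = mk⇔ (to ∘ Equivalence.to (A⇔path (~-sym e))) from
    where
    Goal : Set
    Goal = ∃ λ q → Graph._~_ (label u) (ρ u (v , e)) q × A (marker u q) b

    ee : ~-sym (~-sym e) ≡ e
    ee = T-irrelevant _ _

    to : Alternating labelKind (extremity (~-sym (~-sym e))) (leaf b) → Goal
    -- Reversing `e` twice gives `e` only up to a propositional equality, which is matched here.
    to path with ~-sym (~-sym e) | ee
    to (labelEdge r~q ∷ path) | _ | refl = _ , r~q , Equivalence.from A-marker⇔path path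

    from : Goal → A (extremity (~-sym e)) b
    from (q , r~q , b∈A) = Equivalence.from (A⇔path (~-sym e))
      (subst (λ e → Alternating labelKind (extremity e) (leaf b)) (sym ee)
        (labelEdge r~q ∷ Equivalence.to A-marker⇔path b∈A))

  L-opposite⇔ : ∀ {u v b} (e : node u ~ v) → L (extremity (~-sym e)) b ⇔
                (∃ λ q → q ≢ ρ u (v , e) × L (marker u q) b)
  L-opposite⇔ {u} {v} {b} e = mk⇔ (to ∘ Equivalence.to (L⇔branch (~-sym e))) from
    where
    to : Branch v (node u) (leaf b) → ∃ λ q → q ≢ ρ u (v , e) × L (marker u q) b
    to p with L-cover u b
    ... | q , b∈L = q , (λ { refl → branch-opposite e (Equivalence.to (L⇔branch e) b∈L) p }) , b∈L

    from : (∃ λ q → q ≢ ρ u (v , e) × L (marker u q) b) → L (extremity (~-sym e)) b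
    from (_ , q≢ , c , e′ , refl , p) = Equivalence.from (L⇔branch (~-sym e))
      (branch-enter e′ (λ { refl → q≢ (cong (λ e → ρ u (v , e)) (T-irrelevant _ _)) }) p (~-sym e))

  -- States in a reduced graph-labelled tree

  module _ (reduced : IsReduced) where

    A-nonempty : ∀ u q → ∃ λ b → A (marker u q) b
    A-nonempty u q with ρ-surjective u q
    ... | _ , e , refl =
      let b , path = accessible-leaf reduced e in b , Equivalence.from A-marker⇔path path

    perfect⇒nonempty : ∀ {u q} → IsPerfect (marker u q) → ∃ λ b → b ∈ S × L (marker u q) b
    perfect⇒nonempty {u} {q} (_ , A⊆) = let b , b∈A = A-nonempty u q in b , A⊆ b∈A

    empty⇒¬perfect : ∀ {u q} → IsEmpty (marker u q) → ¬ IsPerfect (marker u q)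
    empty⇒¬perfect empty perfect = let b , b∈ = perfect⇒nonempty perfect in empty b b∈

    module PerfectSet (u : Node)
      (decided : ∀ q → IsPerfect (marker u q) ⊎ IsEmpty (marker u q)) where

      perfectSet : Subset (size u)
      perfectSet = tabulate ([ (λ _ → inside) , (λ _ → outside) ]′ ∘ decided)

      isPerfectSet : IsPerfectSet u perfectSet
      isPerfectSet q = mk⇔
        (λ q∈P → to (decided q) (trans (sym (lookup∘tabulate _ q)) ([]=⇒lookup q∈P)))
        (λ perfect → lookup⇒[]= q _ (trans (lookup∘tabulate _ q) (from (decided q) perfect)))
        where
        to : (d : IsPerfect (marker u q) ⊎ IsEmpty (marker u q)) →
             [ (λ _ → inside) , (λ _ → outside) ]′ d ≡ inside → IsPerfect (marker u q)
        to (inj₁ perfect) _ = perfect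

        from : (d : IsPerfect (marker u q) ⊎ IsEmpty (marker u q)) →
               IsPerfect (marker u q) → [ (λ _ → inside) , (λ _ → outside) ]′ d ≡ inside
        from (inj₁ _)     _       = refl
        from (inj₂ empty) perfect = contradiction perfect (empty⇒¬perfect empty)

      perfect : ∀ {q} → q ∈ perfectSet → IsPerfect (marker u q)
      perfect = Equivalence.to (isPerfectSet _)

      occupied⇒perfect : ∀ {q b} → b ∈ S → L (marker u q) b → q ∈ perfectSet
      occupied⇒perfect {q} b∈S b∈L with decided q
      ... | inj₁ perfect = Equivalence.from (isPerfectSet q) perfect
      ... | inj₂ empty   = contradiction (b∈S , b∈L) (empty _)

      ∈S⇔path : ∀ b → b ∈ S ⇔ (∃ λ q → q ∈ perfectSet × Alternating treeKind (marker u q) (leaf b))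
      ∈S⇔path b = mk⇔ to from
        where
        to : b ∈ S → ∃ λ q → q ∈ perfectSet × Alternating treeKind (marker u q) (leaf b)
        to b∈S with L-cover u b
        ... | q , b∈L = q , q∈P , Equivalence.to A-marker⇔path (proj₁ (perfect q∈P) (b∈S , b∈L))
          where q∈P = occupied⇒perfect b∈S b∈L

        from : (∃ λ q → q ∈ perfectSet × Alternating treeKind (marker u q) (leaf b)) → b ∈ S
        from (q , q∈P , path) = proj₁ (proj₂ (perfect q∈P) (Equivalence.from A-marker⇔path path))

      module _ {v} (e : node u ~ v) where
        private
          r = ρ u (v , e)

        pendant⇒opposite-empty : (∀ y → y ∈ perfectSet → y ≡ r) → IsEmpty (extremity (~-sym e))
        pendant⇒opposite-empty only-r b (b∈S , b∈L) with Equivalence.to (L-opposite⇔ e) b∈L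
        ... | q , q≢r , b∈Lq = q≢r (only-r q (occupied⇒perfect b∈S b∈Lq))

        -- `L` of the opposite is the union of `L` over the marker vertices other than `r`, and `A`
        -- the union of `A` over the neighbours of `r`. If these neighbours are exactly the perfect
        -- ones among the others, the two agree on `S`.
        twin⇒opposite-perfect :
          (∀ y → y ≢ r → y ∈ perfectSet ⇔ Graph._~_ (label u) r y) → IsPerfect (extremity (~-sym e))
        twin⇒opposite-perfect twin = to , from
          where
          to : ∀ {b} → b ∈ S × L (extremity (~-sym e)) b → A (extremity (~-sym e)) b
          to (b∈S , b∈L) with Equivalence.to (L-opposite⇔ e) b∈L
          ... | q , q≢r , b∈Lq = Equivalence.from (A-opposite⇔ e)
            (q , Equivalence.to (twin q q≢r) q∈P , proj₁ (perfect q∈P) (b∈S , b∈Lq))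
            where q∈P = occupied⇒perfect b∈S b∈Lq

          from : ∀ {b} → A (extremity (~-sym e)) b → b ∈ S × L (extremity (~-sym e)) b
          from b∈A with Equivalence.to (A-opposite⇔ e) b∈A
          ... | q , r~q , b∈Aq =
            let q≢r       = λ { refl → Graph.~-irrefl (label u) refl r~q }
                b∈S , b∈L = proj₂ (perfect (Equivalence.from (twin q q≢r) r~q)) b∈Aq
            in b∈S , Equivalence.from (L-opposite⇔ e) (q , q≢r , b∈L)

-- Attaching the new leaf

module Attach {n} (𝒯 : RawGLT n) (isGLT : RawGLT.IsGLT 𝒯)
              (u : RawGLT.Node 𝒯) (P : Subset (RawGLT.size 𝒯 u)) where
  open GLT 𝒯 isGLT

  𝒯⁺ : RawGLT (suc n)
  𝒯⁺ = attachLeaf 𝒯 u P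

  module ⁺ = RawGLT 𝒯⁺

  raise : TreeVertex → ⁺.TreeVertex
  raise (leaf ℓ) = leaf (suc ℓ)
  raise (node w) = node w

  -- Contracts the new edge onto `u`, so that walks in the attached tree project to the old one.
  lower : ⁺.TreeVertex → TreeVertex
  lower (leaf zero)    = node u
  lower (leaf (suc ℓ)) = leaf ℓ
  lower (node w)       = node w

  raise-~ : ∀ a b → a ~ b → raise a ⁺.~ raise b
  raise-~ (leaf _) (leaf _) e = e
  raise-~ (leaf _) (node _) e = e
  raise-~ (node _) (leaf _) e = e
  raise-~ (node _) (node _) e = e

  newEdge : leaf zero ⁺.~ node u
  newEdge = fromWitness refl

  data ArcView : ∀ a b → a ⁺.~ b → Set where
    old : ∀ a b (e : a ~ b) → ArcView (raise a) (raise b) (raise-~ a b e)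
    out : ∀ e → ArcView (leaf zero) (node u) e
    inn : ∀ e → ArcView (node u) (leaf zero) e

  arcView : ∀ a b (e : a ⁺.~ b) → ArcView a b e
  arcView (leaf zero)    (node w)       e with toWitness e
  ... | refl = out e
  arcView (node w)       (leaf zero)    e with toWitness e
  ... | refl = inn e
  arcView (leaf (suc a)) (leaf (suc b)) e = old (leaf a) (leaf b) e
  arcView (leaf (suc a)) (node w)       e = old (leaf a) (node w) e
  arcView (node w)       (leaf (suc b)) e = old (node w) (leaf b) e
  arcView (node w)       (node w′)      e = old (node w) (node w′) e

  data IncidentView : ∀ w b → node w ⁺.~ b → Set where
    old : ∀ {w} b (e : node w ~ b) → IncidentView w (raise b) (raise-~ (node w) b e)
    new : ∀ e → IncidentView u (leaf zero) e

  incidentView : ∀ w b e → IncidentView w b e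
  incidentView w (leaf zero)    e with toWitness e
  ... | refl = new e
  incidentView w (leaf (suc b)) e = old (leaf b) e
  incidentView w (node w′)      e = old (node w′) e

  lower-raise : ∀ a → lower (raise a) ≡ a
  lower-raise (leaf _) = refl
  lower-raise (node _) = refl

  connected⁺ : Connected ⁺.tree
  connected⁺ a b = fromU a ◅◅ Star.reverse (λ {x} {y} → ⁺.~-sym {x} {y}) (fromU b)
    where
    fromU : ∀ a → Star ⁺._~_ a (node u)
    fromU (leaf zero)    = newEdge ◅ ε
    fromU (leaf (suc ℓ)) = Star.gmap raise (λ {x} {y} → raise-~ x y) (proj₁ isTree (leaf ℓ) (node u))
    fromU (node w)       = Star.gmap raise (λ {x} {y} → raise-~ x y) (proj₁ isTree (node w) (node u))

  private
    -- The new leaf has no neighbour but `u`, so a walk out of it must begin with the new edge.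
    new-bridge : ∀ {R : Rel ⁺.TreeVertex 0ℓ} → (∀ {x y} → R x y → x ⁺.~ y) →
                 ¬ R (leaf zero) (node u) → ¬ Star R (leaf zero) (node u)
    new-bridge R⊆~ _  (_◅_ {j = leaf _} r _) = R⊆~ r
    new-bridge R⊆~ ¬R (_◅_ {j = node _} r _) with toWitness (R⊆~ r)
    ... | refl = ¬R r

    contract : ∀ {a b x y} → DeleteEdge ⁺.tree (raise a) (raise b) x y →
               Star (DeleteEdge tree a b) (lower x) (lower y)
    contract {x = x} {y} (d , ≢ab) with arcView x y d
    ... | out _ = ε
    ... | inn _ = ε
    ... | old x y d₀ rewrite lower-raise x | lower-raise y =
      (d₀ , λ { (inj₁ (refl , refl)) → ≢ab (inj₁ (refl , refl))
              ; (inj₂ (refl , refl)) → ≢ab (inj₂ (refl , refl)) }) ◅ ε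

  bridge⁺ : BridgesOnly ⁺.tree
  bridge⁺ {a} {b} e path with arcView a b e
  ... | old a b e₀ = bridge e₀ (subst₂ (Star _) (lower-raise b) (lower-raise a)
      (Star.concat (Star.gmap lower contract path)))
  ... | out _ = new-bridge proj₁ (λ (_ , ≢ab) → ≢ab (inj₁ (refl , refl)))
      (Star.reverse (delete-sym ⁺.tree) path)
  ... | inn _ = new-bridge proj₁ (λ (_ , ≢ab) → ≢ab (inj₂ (refl , refl))) path

  leaf-degree⁺ : ∀ ℓ → ∃! _≡_ (λ v → leaf ℓ ⁺.~ v)
  leaf-degree⁺ zero = node u , newEdge , unique
    where
    unique : ∀ {v} → leaf zero ⁺.~ v → node u ≡ v
    unique {node _} e = cong node (sym (toWitness e))
  leaf-degree⁺ (suc ℓ) with leaf-degree ℓ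
  ... | v , e , unique = raise v , raise-~ (leaf ℓ) v e , unique⁺
    where
    unique⁺ : ∀ {v′} → leaf (suc ℓ) ⁺.~ v′ → raise v ≡ v′
    unique⁺ {leaf (suc _)} e′ = cong raise (unique e′)
    unique⁺ {node _}       e′ = cong raise (unique e′)

  -- Sizes and labels of the attached tree compute only once `w ≟ u` is decided, so the decision `d`
  -- is kept as an argument that can be matched on.
  embed : ∀ {w} (d : Dec (w ≡ u)) → Fin (size w) → Fin (attachedSize 𝒯 u P w d)
  embed (yes _) q = suc q
  embed (no _)  q = q

  newMarker : (d : Dec (u ≡ u)) → Fin (attachedSize 𝒯 u P u d)
  newMarker (yes _)  = zero
  newMarker (no u≢u) = contradiction refl u≢u

  data MarkerView : ∀ {w} (d : Dec (w ≡ u)) → Fin (attachedSize 𝒯 u P w d) → Set where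
    old : ∀ {w d} (q : Fin (size w)) → MarkerView d (embed d q)
    new : ∀ {d} → MarkerView d (newMarker d)

  markerView : ∀ {w} (d : Dec (w ≡ u)) q → MarkerView d q
  markerView (yes refl) zero    = new
  markerView (yes refl) (suc q) = old q
  markerView (no _)     q       = old q

  embed-injective : ∀ {w} (d : Dec (w ≡ u)) {q q′} → embed d q ≡ embed d q′ → q ≡ q′
  embed-injective (yes _) refl = refl
  embed-injective (no _)  refl = refl

  newMarker≢embed : ∀ d {q} → newMarker d ≢ embed d q
  newMarker≢embed (yes _)  ()
  newMarker≢embed (no u≢u) _ = u≢u refl

  ρ-raise : ∀ {w} (d : Dec (w ≡ u)) b (e : node w ~ b) →
            attachedρ 𝒯 u P w d (raise b , raise-~ (node w) b e) ≡ embed d (ρ w (b , e))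
  ρ-raise (yes _) (leaf _) e = refl
  ρ-raise (no _)  (leaf _) e = refl
  ρ-raise (yes _) (node _) e = refl
  ρ-raise (no _)  (node _) e = refl

  ρ-new : (d : Dec (u ≡ u)) (e : node u ⁺.~ leaf zero) →
          attachedρ 𝒯 u P u d (leaf zero , e) ≡ newMarker d
  ρ-new (yes _)  e = refl
  ρ-new (no u≢u) e = contradiction refl u≢u

  ρ-bijective⁺ : ∀ w (d : Dec (w ≡ u)) → Bijective _≡_ _≡_ (attachedρ 𝒯 u P w d)
  ρ-bijective⁺ w d = injective , surjective
    where
    injective : Injective _≡_ _≡_ (attachedρ 𝒯 u P w d)
    injective {v , e} {v′ , e′} eq with incidentView w v e | incidentView w v′ e′
    ... | new e    | new e′    = cong (leaf zero ,_) (T-irrelevant e e′)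
    ... | new e    | old v′ e′ =
      contradiction (trans (sym (ρ-new d e)) (trans eq (ρ-raise d v′ e′))) (newMarker≢embed d)
    ... | old v e  | new e′    =
      contradiction (trans (sym (ρ-new d e′)) (trans (sym eq) (ρ-raise d v e))) (newMarker≢embed d)
    ... | old v e  | old v′ e′ =
      cong (λ (v , e) → raise v , raise-~ (node w) v e)
        (proj₁ (ρ-bijective w)
          (embed-injective d (trans (sym (ρ-raise d v e)) (trans eq (ρ-raise d v′ e′)))))

    surjective : ∀ q → ∃ λ v → ∀ {z} → z ≡ v → attachedρ 𝒯 u P w d z ≡ q
    surjective q with markerView d q
    ... | new   = (leaf zero , newEdge) , λ { refl → ρ-new d newEdge }
    ... | old q with ρ-surjective w q
    ...   | v , e , refl = (raise v , raise-~ (node w) v e) , λ { refl → ρ-raise d v e }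

  size-embed : ∀ w (d : Dec (w ≡ u)) → 3 ≤ attachedSize 𝒯 u P w d
  size-embed w (yes _) = m≤n⇒m≤1+n (node-degree w)
  size-embed w (no _)  = node-degree w

  isGLT⁺ : ⁺.IsGLT
  isGLT⁺ = record
    { isTree      = connected⁺ , bridgesOnly⇒acyclic ⁺.tree bridge⁺
    ; leaf-degree = leaf-degree⁺
    ; ρ-bijective = λ w → ρ-bijective⁺ w (w ≟ u)
    ; node-degree = λ w → size-embed w (w ≟ u)
    }

  -- Accessibility in the attached tree

  module GLT⁺ = GLT 𝒯⁺ isGLT⁺

  raiseElement : Element → ⁺.Element
  raiseElement (leaf ℓ)     = leaf (suc ℓ)
  raiseElement (marker w q) = marker w (embed (w ≟ u) q)

  raiseElement-leaf : ∀ {p b} → raiseElement p ≡ leaf (suc b) → p ≡ leaf b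
  raiseElement-leaf {leaf _} refl = refl

  newElement : ⁺.Element
  newElement = marker u (newMarker (u ≟ u))

  extremity-raise : ∀ a b (e : a ~ b) →
                    ⁺.extremity {raise a} {raise b} (raise-~ a b e) ≡ raiseElement (extremity e)
  extremity-raise (leaf _) _ e = refl
  extremity-raise (node w) b e = cong (marker w) (ρ-raise (w ≟ u) b e)

  opposite-raise : ∀ {p q} → Opposite p q → ⁺.Opposite (raiseElement p) (raiseElement q)
  opposite-raise (a , b , e , refl , refl) =
    raise a , raise b , raise-~ a b e , sym (extremity-raise a b e) ,
    trans (sym (extremity-raise b a (~-sym e)))
      (cong (⁺.extremity {raise b} {raise a}) (T-irrelevant _ _))

  opposite-new : ⁺.Opposite (leaf zero) newElement
  opposite-new = leaf zero , node u , newEdge , refl , cong (marker u) (sym (ρ-new (u ≟ u) _))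

  -- The raised opposite of `p` is an opposite in the attached tree, and there is only one.
  opposite-lower : ∀ {p y} → ⁺.Opposite (raiseElement p) y → ∃ λ q → y ≡ raiseElement q × Opposite p q
  opposite-lower {p} opp with everyExtremity p
  ... | isExtremity e =
    _ , GLT⁺.opposite-unique opp (opposite-raise (opposite e)) , opposite e

  adj-embed : ∀ {w} (d : Dec (w ≡ u)) q q′ →
              Graph.adj (attachedLabel 𝒯 u P w d) (embed d q) (embed d q′) ≡ Graph.adj (label w) q q′
  adj-embed (yes refl) q q′ = refl
  adj-embed (no _)     q q′ = refl

  adj-new : (d : Dec (u ≡ u)) → ∀ q →
            Graph.adj (attachedLabel 𝒯 u P u d) (newMarker d) (embed d q) ≡ lookup P q
  adj-new (yes refl) q = refl
  adj-new (no u≢u)   q = contradiction refl u≢u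

  labelEdge-raise : ∀ {p q} → LabelEdge p q → ⁺.LabelEdge (raiseElement p) (raiseElement q)
  labelEdge-raise (labelEdge {w} {q} {q′} e) = ⁺.labelEdge (subst T (sym (adj-embed (w ≟ u) q q′)) e)

  labelEdge-new : ∀ {q} → q ∈ P → ⁺.LabelEdge newElement (raiseElement (marker u q))
  labelEdge-new {q} q∈P = ⁺.labelEdge (subst T (sym (adj-new (u ≟ u) q)) (∈⇒T q∈P))

  labelEdge-lower : ∀ {p y} → ⁺.LabelEdge (raiseElement p) y →
                    y ≡ newElement ⊎ ∃ λ q → y ≡ raiseElement q × LabelEdge p q
  labelEdge-lower {marker w q} (⁺.labelEdge {q′ = q′} e) with markerView (w ≟ u) q′
  ... | new    = inj₁ refl
  ... | old q′ = inj₂ (marker w q′ , refl , labelEdge (subst T (adj-embed (w ≟ u) q q′) e))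

  labelEdge-from-new : ∀ {y} → ⁺.LabelEdge newElement y →
                       ∃ λ q → q ∈ P × y ≡ raiseElement (marker u q)
  labelEdge-from-new (⁺.labelEdge {q′ = q} e) with markerView (u ≟ u) q
  ... | new   = contradiction e (Graph.~-irrefl (⁺.label u) refl)
  ... | old q = q , T⇒∈ (subst T (adj-new (u ≟ u) q) e) , refl

  -- Each graph-labelled tree has its own type `Kind`, so kinds need translating.
  kind⁺ : Kind → ⁺.Kind
  kind⁺ treeKind  = ⁺.treeKind
  kind⁺ labelKind = ⁺.labelKind

  kind : ⁺.Kind → Kind
  kind ⁺.treeKind  = treeKind
  kind ⁺.labelKind = labelKind

  path-raise : ∀ {k p q} → Alternating k p q →
               ⁺.Alternating (kind⁺ k) (raiseElement p) (raiseElement q)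
  path-raise             []         = ⁺.[]
  path-raise {treeKind}  (s ∷ path) = opposite-raise s ⁺.∷ path-raise path
  path-raise {labelKind} (s ∷ path) = labelEdge-raise s ⁺.∷ path-raise path

  -- A path cannot turn back after entering the new leaf.
  path-lower : ∀ {k p b} → ⁺.Alternating k (raiseElement p) (leaf (suc b)) →
               Alternating (kind k) p (leaf b)
  path-lower path = go path refl
    where
    go : ∀ {k p x b} → ⁺.Alternating k x (leaf (suc b)) → x ≡ raiseElement p →
         Alternating (kind k) p (leaf b)
    go ⁺.[] eq with raiseElement-leaf (sym eq)
    ... | refl = []
    go {⁺.treeKind} (opp ⁺.∷ path) refl with opposite-lower opp
    ... | _ , eq , opp′ = opp′ ∷ go path eq
    go {⁺.labelKind} (e ⁺.∷ path) refl with labelEdge-lower e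
    ... | inj₂ (_ , eq , e′) = e′ ∷ go path eq
    go {⁺.labelKind} (e ⁺.∷ (opp ⁺.∷ path)) refl | inj₁ refl
      with GLT⁺.opposite-unique opp (GLT⁺.opposite-sym opposite-new)
    go {⁺.labelKind} (e ⁺.∷ (opp ⁺.∷ (() ⁺.∷ _))) refl | inj₁ refl | refl

  accessibility-old : ∀ {a b} → AccessibilityGraph a b ⇔ ⁺.AccessibilityGraph (suc a) (suc b)
  accessibility-old = mk⇔
    (λ (a≢b , k , path) → a≢b ∘ suc-injective , kind⁺ k , path-raise path)
    (λ (a≢b , k , path) → a≢b ∘ cong suc , kind k , path-lower path)

  accessibility-new : ∀ {b} → (∃ λ q → q ∈ P × Alternating treeKind (marker u q) (leaf b)) ⇔
                      ⁺.AccessibilityGraph zero (suc b)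
  accessibility-new {b} = mk⇔
    (λ (_ , q∈P , path) →
      (λ ()) , ⁺.treeKind , opposite-new ⁺.∷ labelEdge-new q∈P ⁺.∷ path-raise path)
    (λ (_ , _ , path) → from path)
    where
    from : ∀ {k} → ⁺.Alternating k (leaf zero) (leaf (suc b)) →
           ∃ λ q → q ∈ P × Alternating treeKind (marker u q) (leaf b)
    from {⁺.treeKind} (opp ⁺.∷ path) with GLT⁺.opposite-unique opp opposite-new
    from {⁺.treeKind} (opp ⁺.∷ (e ⁺.∷ path)) | refl with labelEdge-from-new e
    ... | q , q∈P , refl = q , q∈P , path-lower path

  -- Joins

  -- The new tree-edge ends at a leaf, so every tree-edge that could be joined is old.
  opposite-markers-lower : ∀ {w w′ q q′} → ⁺.Opposite (marker w q) (marker w′ q′) →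
    ∃₂ λ q₀ q₀′ → q ≡ embed (w ≟ u) q₀ × q′ ≡ embed (w′ ≟ u) q₀′ ×
                  Opposite (marker w q₀) (marker w′ q₀′)
  opposite-markers-lower (node w , node w′ , e , refl , refl) =
    _ , _ , ρ-raise (w ≟ u) (node w′) e , ρ-raise (w′ ≟ u) (node w) (~-sym e) ,
    opposite {node w} {node w′} e

  -- A clique without its new vertex is a clique. For stars, a join also depends on which marker
  -- vertex is the centre, and `star⁺` asks that old marker vertices keep this role.
  module Reduced (reduced : IsReduced)
    (label⁺ : IsPrime (addVertex (label u) P) ⊎ IsDegenerate (addVertex (label u) P))
    (star⁺ : IsStar (addVertex (label u) P) → IsStar (label u) ×
             ∀ q → IsStarWithCentre (addVertex (label u) P) (suc q) ⇔ IsStarWithCentre (label u) q)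
    where

    label-embed : ∀ {w} (d : Dec (w ≡ u)) →
                  IsPrime (attachedLabel 𝒯 u P w d) ⊎ IsDegenerate (attachedLabel 𝒯 u P w d)
    label-embed (yes refl) = label⁺
    label-embed {w} (no _) = proj₁ reduced w

    clique-embed : ∀ {w} (d : Dec (w ≡ u)) → IsClique (attachedLabel 𝒯 u P w d) → IsClique (label w)
    clique-embed (yes refl) clique = addVertex-clique⇒clique (label u) P clique
    clique-embed (no _)     clique = clique

    star-embed : ∀ {w} (d : Dec (w ≡ u)) → IsStar (attachedLabel 𝒯 u P w d) → IsStar (label w) ×
                 ∀ q → IsStarWithCentre (attachedLabel 𝒯 u P w d) (embed d q) ⇔
                       IsStarWithCentre (label w) q
    star-embed (yes refl) star = star⁺ star
    star-embed (no _)     star = star , λ _ → mk⇔ (λ c → c) (λ c → c)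

    isReduced⁺ : ⁺.IsReduced
    isReduced⁺ = (λ w → label-embed (w ≟ u)) , ¬cliqueJoin , ¬starJoin
      where
      ¬cliqueJoin : ¬ ⁺.CliqueJoinPossible
      ¬cliqueJoin (w , w′ , _ , _ , opp , clique , clique′) with opposite-markers-lower opp
      ... | q , q′ , refl , refl , opp₀ = proj₁ (proj₂ reduced)
        (w , w′ , q , q′ , opp₀ , clique-embed (w ≟ u) clique , clique-embed (w′ ≟ u) clique′)

      ¬starJoin : ¬ ⁺.StarJoinPossible
      ¬starJoin (w , w′ , _ , _ , opp , star , star′ , centres) with opposite-markers-lower opp
      ... | q , q′ , refl , refl , opp₀ with star-embed (w ≟ u) star | star-embed (w′ ≟ u) star′
      ... | star₀ , centre⇔ | star₀′ , centre⇔′ = proj₂ (proj₂ reduced)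
        (w , w′ , q , q′ , opp₀ , star₀ , star₀′ , Sum.map
          (λ (c , ¬c′) → to (centre⇔ q) c , ¬c′ ∘ from (centre⇔′ q′))
          (λ (¬c , c′) → ¬c ∘ from (centre⇔ q) , to (centre⇔′ q′) c′)
          centres)
        where open Equivalence

-- The split-tree of G+x

proposition4p15 : (n : ℕ) (G : Graph (Fin n)) (S : Subset n) →
    Connected G → Connected (addVertex G S) →
    (𝒯 : RawGLT n) → 𝒯 IsSplitTreeOf G →
    let open RawGLT 𝒯
        open States 𝒯 S in
    (u : Node) →
    ( IsUnique IsPerfectClique u
    ⊎ IsUnique IsCentrePerfectStar u
    ⊎ (IsUnique IsHybrid u × IsPrime (label u))) →
    ∃ λ P → IsPerfectSet u P ×
            attachLeaf 𝒯 u P IsSplitTreeOf addVertex G S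
proposition4p15 n G S _ connected 𝒯 splitTree u cases =
  P , isPerfectSet , record
    { isGLT         = isGLT⁺
    ; isReduced     = isReduced⁺
    ; accessibility = adjacent⇔
    }
  where
  open _IsSplitTreeOf_ splitTree
  open GLT 𝒯 isGLT
  open States 𝒯 S
  open StateProperties 𝒯 isGLT S
  open Equivalence

  Case : Set
  Case = IsUnique IsPerfectClique u
       ⊎ IsUnique IsCentrePerfectStar u
       ⊎ (IsUnique IsHybrid u × IsPrime (label u))

  decide : Case → ∀ q → IsPerfect (marker u q) ⊎ IsEmpty (marker u q)
  decide (inj₁ ((_ , perfect) , _))       q = inj₁ (perfect q)
  decide (inj₂ (inj₂ ((hybrid , _) , _))) q = proj₁ (hybrid q)
  decide (inj₂ (inj₁ ((c , _ , perfect , empty) , _))) q with q ≟ c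
  ... | yes refl = inj₁ perfect
  ... | no  q≢c  = inj₂ (empty q q≢c)

  open PerfectSet isReduced u (decide cases) renaming (perfectSet to P)
  open Attach 𝒯 isGLT u P

  -- Some old leaf lies beyond an edge at `u`, and the first step of a walk from x to it in G+x ends
  -- in `S`.
  leaf-of-S : ∃ λ b → b ∈ S
  leaf-of-S with ρ-surjective u (fromℕ< (≤-trans (s≤s z≤n) (node-degree u)))
  ... | _ , e , _ with accessible-leaf isReduced e
  ... | b , _ with connected zero (suc b)
  ... | _◅_ {j = suc b′} b′∈S _ = b′ , T⇒∈ b′∈S

  P-nonempty : Nonempty P
  P-nonempty = let b , b∈S = leaf-of-S
                   q , q∈P , _ = to (∈S⇔path b) b∈S
               in q , q∈P

  newLabel : Case →
             (IsPrime (addVertex (label u) P) ⊎ IsDegenerate (addVertex (label u) P)) ×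
             (IsStar (addVertex (label u) P) → IsStar (label u) ×
              ∀ q → IsStarWithCentre (addVertex (label u) P) (suc q) ⇔ IsStarWithCentre (label u) q)
  newLabel (inj₁ ((clique , perfect) , _)) =
    -- A star has two non-adjacent vertices besides its centre, so the condition on stars is vacuous
    -- for a clique.
    inj₂ (inj₁ clique⁺) , λ star → contradiction star (clique⇒¬star (addVertex (label u) P) clique⁺)
    where clique⁺ = addVertex-clique (label u) P clique (λ q → from (isPerfectSet q) (perfect q))
  newLabel (inj₂ (inj₁ ((c , star , perfect-c , empty) , _))) =
    inj₂ (inj₂ (suc c , star⁺)) , λ _ → (c , star) , λ q → mk⇔
      (addVertex-star⇒star (label u) P (node-degree u))
      -- The old star has only one centre, so `q` is `c`.
      (λ star-q → subst (IsStarWithCentre (addVertex (label u) P) ∘ suc)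
        (sym (centre-unique (label u) star star-q)) star⁺)
    where
    star⁺ : IsStarWithCentre (addVertex (label u) P) (suc c)
    star⁺ = addVertex-star (label u) P star λ q → mk⇔
      (λ q∈P → case q ≟ c of λ where
        (yes q≡c) → q≡c
        (no  q≢c) → contradiction (perfect q∈P) (empty⇒¬perfect isReduced (empty q q≢c)))
      (λ { refl → from (isPerfectSet c) perfect-c })
  newLabel (inj₂ (inj₂ ((hybrid , _) , prime))) =
    inj₁ prime⁺ , λ star → contradiction (inj₂ star) (proj₂ (proj₂ prime⁺))
    where
    mixed : ∀ {v} (e : node u ~ v) → IsMixed (extremity (~-sym e))
    mixed e = proj₂ (hybrid _) _ (opposite e)

    ¬pendant : ∀ r → ¬ (∀ y → y ∈ P → y ≡ r)
    ¬pendant r only-r with ρ-surjective u r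
    ... | _ , e , refl = proj₂ (mixed e) (pendant⇒opposite-empty e only-r)

    ¬twin : ∀ r → ¬ (∀ y → y ≢ r → y ∈ P ⇔ Graph._~_ (label u) r y)
    ¬twin r twin with ρ-surjective u r
    ... | _ , e , refl = proj₁ (mixed e) (twin⇒opposite-perfect e twin)

    prime⁺ : IsPrime (addVertex (label u) P)
    prime⁺ = addVertex-prime (label u) P (node-degree u) prime P-nonempty ¬pendant ¬twin

  open Reduced isReduced (proj₁ (newLabel cases)) (proj₂ (newLabel cases))

  _⇔∘_ : ∀ {A B C : Set} → A ⇔ B → B ⇔ C → A ⇔ C
  f ⇔∘ g = mk⇔ (to g ∘ to f) (from f ∘ from g)

  new⇔ : ∀ b → T (lookup S b) ⇔ ⁺.AccessibilityGraph zero (suc b)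
  new⇔ b = mk⇔ T⇒∈ ∈⇒T ⇔∘ (∈S⇔path b ⇔∘ accessibility-new)

  adjacent⇔ : ∀ a b → Graph._~_ (addVertex G S) a b ⇔ ⁺.AccessibilityGraph a b
  adjacent⇔ zero    zero    = mk⇔ (λ ()) (λ (0≢0 , _) → 0≢0 refl)
  adjacent⇔ zero    (suc b) = new⇔ b
  adjacent⇔ (suc a) zero    = new⇔ a ⇔∘ mk⇔ GLT⁺.accessibility-sym GLT⁺.accessibility-sym
  adjacent⇔ (suc a) (suc b) = accessibility a b ⇔∘ accessibility-old
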